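{- Let $G=(V,E)$ be a connected graph with chromatic number $\chi(G)=k+1$, where $k\ge 2$. Then for any maximum contrast greyscale $f$ of $G$, the set $\mathrm{Im}(f)$ is a $\frac1k$-minimum-step-enchained set, and $I_k\subset \mathrm{Im}(f)\subset F_k$ (inclusions not necessarily strict), where $I_k=\{\frac ik : i=0,1,\dots,k\}$.
   Context: Graphs are finite, undirected and simple. A greyscale of $G=(V,E)$ is a map $f:V\to[0,1]$ with $0,1\in \mathrm{Im}(f)$. For $e=\{u,v\}\in E$ put $\widehat f(e)=|f(u)-f(v)|$. The contrast vector $cont(G,f)$ is the vector of all values $\widehat f(e)$, $e\in E$, listed in ascending order; contrast vectors are compared lexicographically, and a maximum contrast greyscale is a greyscale whose contrast vector is the lexicographic maximum among all greyscales of $G$. For $r\ge 2$ and $p>0$, a $p$-step chain of length $r$ in $[0,1]$ is a sequence $[y_0,y_1,\dots,y_r]\subset[0,1]$ with $y_i-y_{i-1}=p$ for $i=1,\dots,r$; $y_0,y_r$ are its extreme points and the $y_i$ with $0<i<r$ are its interior points. A chain is in a set $F$ if all its points belong to $F$. A set $F\subset[0,1]$ is an $h$-minimum-step-enchained set if: (1) there is an $h$-step chain in $F$ with extreme points $0$ and $1$, and there is no $q$-step chain in $F$ with extreme points $0,1$ and $q<h$; (2) for every $y\in F-\{0,1\}$ there is a $p$-step chain in $F$, for some $p\ge h$, with extreme points $y_1,y_2$, having $y$ as an interior point, and such that, if $p>h$ and $y_i\notin\{0,1\}$ ($i=1$ or $2$), then $y_i$ is an interior point of a $q_i$-step chain in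 $F$ with $h\le q_i<p$. The set $F_k\subset[0,1]$ ($k\ge2$) is the set generated by the following recursive procedure. Start with $H=\{0,1\}$, where $0$ and $1$ carry the value $0$. Whenever $y_1<y_2$ are in $H$, $r\ge 2$ is an integer, $p=\frac{y_2-y_1}{r}\ge\frac1k$, and $p$ is strictly larger than the (smallest) values currently carried by $y_1$ and by $y_2$, add to $H$ all interior points $y_1+jp$ ($1\le j\le r-1$) of the $p$-step chain with extreme points $y_1,y_2$; each such interior point carries the value $p$ (the smallest such $p$, if it arises several times). Repeat as long as possible; $F_k$ is the set of all numbers so obtained. Equivalently: let $R$ be the smallest set of pairs of real numbers such that $(0,0),(1,0)\in R$ and, whenever $(y_1,q_1),(y_2,q_2)\in R$, $y_1<y_2$, $r\ge2$ is an integer, $p=\frac{y_2-y_1}{r}\ge\frac1k$ and $p>\max\{q_1,q_2\}$, then $(y_1+jp,\,p)\in R$ for $j=1,\dots,r-1$; then $F_k=\{y : (y,q)\in R \text{ for some } q\}$. -}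

module Defs where

open import Algebra.Core using (Op₁; Op₂)
open import Algebra.Structures using (IsCommutativeRing)
open import Algebra.Bundles using (CommutativeRing)
open import Data.Bool.Base using (if_then_else_)
open import Data.Fin.Base as Fin using (Fin; toℕ; fromℕ; inject₁)
import Data.Fin.Properties as Fin
open import Data.List.Base using (List; map; filter; allFin; cartesianProduct)
open import Data.List.Relation.Binary.Lex.NonStrict using (Lex-≤)
import Data.List.Sort as Sort
open import Data.Nat.Base as ℕ using (ℕ; zero; suc)
open import Data.Product.Base using (Σ; ∃; ∃-syntax; _×_; _,_)
open import Level using (0ℓ) renaming (suc to lsuc)
open import Relation.Binary.Core using (Rel)
open import Relation.Binary.Bundles using (DecTotalOrder)
open import Relation.Binary.Construct.Closure.ReflexiveTransitive using (Star)
import Relation.Binary.Construct.NonStrictToStrict as ToStrict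
open import Relation.Binary.Definitions using (Decidable; Symmetric; Irreflexive)
open import Relation.Binary.PropositionalEquality.Core using (_≡_; _≢_)
open import Relation.Binary.Structures using (IsDecTotalOrder)
open import Relation.Nullary.Decidable using (does; _×-dec_)
open import Relation.Nullary.Negation.Core using (¬_)
open import Relation.Unary using (Pred; _∈_; _⊆_; Satisfiable)

-- The real numbers, characterised up to isomorphism as a complete ordered
-- field. The order is taken to be decidable and suprema are total, as for the
-- classical reals. The value of 0# ⁻¹ is unconstrained.
record RealField : Set (lsuc 0ℓ) where
  infix  4 _≤_
  infixl 6 _+_
  infixl 7 _*_
  infix  8 -_
  infix  9 _⁻¹
  field
    Carrier           : Set
    _≤_               : Rel Carrier 0ℓ
    _+_ _*_           : Op₂ Carrier
    -_ _⁻¹            : Op₁ Carrier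
    0# 1#             : Carrier
    isCommutativeRing : IsCommutativeRing _≡_ _+_ _*_ -_ 0# 1#
    0≢1               : 0# ≢ 1#
    ⁻¹-inverseʳ       : ∀ x → x ≢ 0# → x * x ⁻¹ ≡ 1#
    isDecTotalOrder   : IsDecTotalOrder _≡_ _≤_
    +-monoˡ-≤         : ∀ z {x y} → x ≤ y → x + z ≤ y + z
    *-nonNegative     : ∀ {x y} → 0# ≤ x → 0# ≤ y → 0# ≤ x * y
    supremum          : (P : Pred Carrier 0ℓ) → Satisfiable P →
                        (∃[ b ] (∀ x → x ∈ P → x ≤ b)) →
                        ∃[ s ] (∀ x → x ∈ P → x ≤ s) ×
                               (∀ b → (∀ x → x ∈ P → x ≤ b) → s ≤ b)

  commutativeRing : CommutativeRing 0ℓ 0ℓ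
  commutativeRing = record { isCommutativeRing = isCommutativeRing }

  decTotalOrder : DecTotalOrder 0ℓ 0ℓ 0ℓ
  decTotalOrder = record { isDecTotalOrder = isDecTotalOrder }

  open IsDecTotalOrder isDecTotalOrder public using (_≤?_)

  infix 4 _<_
  _<_ : Rel Carrier 0ℓ
  _<_ = ToStrict._<_ _≡_ _≤_

  infixl 6 _-_
  _-_ : Op₂ Carrier
  x - y = x + - y

  ∣_∣ : Op₁ Carrier
  ∣ x ∣ = if does (0# ≤? x) then x else - x

  ι : ℕ → Carrier
  ι zero    = 0#
  ι (suc n) = 1# + ι n

  infixl 7 _/_
  _/_ : Carrier → ℕ → Carrier
  x / n = x * (ι n) ⁻¹

record Graph : Set (lsuc 0ℓ) where
  infix 4 _~_ _~?_
  field
    order  : ℕ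
    _~_    : Rel (Fin order) 0ℓ
    _~?_   : Decidable _~_
    sym    : Symmetric _~_
    irrefl : Irreflexive _≡_ _~_

  Vertex : Set
  Vertex = Fin order

  -- The edge {u , v} is listed once, as (u , v) with u < v.
  edges : List (Vertex × Vertex)
  edges = filter (λ (u , v) → (u Fin.<? v) ×-dec (u ~? v))
                 (cartesianProduct (allFin order) (allFin order))

  Connected : Set
  Connected = ∀ u v → Star _~_ u v

  Colorable : ℕ → Set
  Colorable m = Σ (Vertex → Fin m) λ c → ∀ {u v} → u ~ v → c u ≢ c v

  HasChromaticNumber : ℕ → Set
  HasChromaticNumber m = Colorable m × (∀ l → Colorable l → m ℕ.≤ l)

module Contrast (ℝ : RealField) where
  open RealField ℝ public

  UnitInterval : Pred Carrier 0ℓ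
  UnitInterval x = 0# ≤ x × x ≤ 1#

  module _ (G : Graph) where
    open Graph G

    Im : (Vertex → Carrier) → Pred Carrier 0ℓ
    Im f y = ∃[ v ] f v ≡ y

    IsGreyscale : (Vertex → Carrier) → Set
    IsGreyscale f = (∀ v → f v ∈ UnitInterval) × 0# ∈ Im f × 1# ∈ Im f

    cont : (Vertex → Carrier) → List Carrier
    cont f = Sort.sort decTotalOrder (map (λ (u , v) → ∣ f u - f v ∣) edges)

    IsMaximumContrastGreyscale : (Vertex → Carrier) → Set
    IsMaximumContrastGreyscale f =
      IsGreyscale f ×
      (∀ g → IsGreyscale g → Lex-≤ _≡_ _≤_ (cont g) (cont f))

  record IsChain (p : Carrier) (r : ℕ) (y : Fin (suc r) → Carrier) : Set where
    field
      2≤r  : 2 ℕ.≤ r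
      0<p  : 0# < p
      unit : ∀ i → y i ∈ UnitInterval
      step : ∀ (i : Fin r) → y (Fin.suc i) - y (inject₁ i) ≡ p

  record ChainIn (F : Pred Carrier 0ℓ) (p a b : Carrier) : Set where
    field
      {r}     : ℕ
      point   : Fin (suc r) → Carrier
      isChain : IsChain p r point
      inF     : ∀ i → point i ∈ F
      first   : point Fin.zero ≡ a
      last    : point (fromℕ r) ≡ b

    Interior : Pred Carrier 0ℓ
    Interior y = ∃[ i ] 0 ℕ.< toℕ i × toℕ i ℕ.< r × point i ≡ y

  IsInteriorOf : (F : Pred Carrier 0ℓ) (p a b y : Carrier) → Set
  IsInteriorOf F p a b y = Σ (ChainIn F p a b) λ c → y ∈ ChainIn.Interior c

  record IsMinimumStepEnchained (h : Carrier) (F : Pred Carrier 0ℓ) : Set where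
    Supported : (p y : Carrier) → Set
    Supported p y = h < p → y ≢ 0# → y ≢ 1# →
      ∃[ q ] h ≤ q × q < p × ∃[ a ] ∃[ b ] IsInteriorOf F q a b y

    field
      unit     : F ⊆ UnitInterval
      chain    : ChainIn F h 0# 1#
      minimum  : ∀ q → q < h → ¬ ChainIn F q 0# 1#
      interior : ∀ y → y ∈ F → y ≢ 0# → y ≢ 1# →
        ∃[ p ] h ≤ p × ∃[ y₁ ] ∃[ y₂ ]
          IsInteriorOf F p y₁ y₂ y × Supported p y₁ × Supported p y₂

  -- R k y q: the point y can be generated carrying the value q. A point may
  -- carry several values; comparing p with some values carried by y₁ and y₂ is
  -- the same as comparing it with the smallest ones.
  data R (k : ℕ) : Carrier → Carrier → Set where
    zero     : R k 0# 0#
    one      : R k 1# 0#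
    generate : ∀ {y₁ q₁ y₂ q₂ r p j} →
      R k y₁ q₁ → R k y₂ q₂ → y₁ < y₂ →
      2 ℕ.≤ r → p ≡ (y₂ - y₁) / r → 1# / k ≤ p → q₁ < p → q₂ < p →
      1 ℕ.≤ j → j ℕ.< r →
      R k (y₁ + ι j * p) p

  F : ℕ → Pred Carrier 0ℓ
  F k y = ∃[ q ] R k y q

  I : ℕ → Pred Carrier 0ℓ
  I k y = ∃[ i ] i ℕ.≤ k × y ≡ ι i / k

{-# OPTIONS --safe #-}
module Submission where

-- The shades i / k of a proper (k + 1)-colouring form a greyscale whose
-- contrasts are all at least 1 / k, so the same holds for a maximum contrast
-- greyscale f; were i / k not a value of f, the cells of the grid would
-- k-colour G. If p is the smallest contrast at a vertex v with 0 < f v < 1, then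
-- v has neighbours of shade f v - p and f v + p, since otherwise moving f v
-- slightly would improve the contrast vector. Iterating upwards and downwards
-- gives a p-step chain through f v, which stops only at 0, at 1, or at a vertex
-- whose smallest contrast is below p. Well-founded induction on the smallest
-- contrast turns these chains into a derivation of f v in F k, and F k has no
-- points strictly between 0 and 1 / k, so that no finer chain joins 0 to 1.

open import Defs
open import Algebra.Bundles using (CommutativeRing)
import Algebra.Properties.Ring as RingProperties
open import Data.Fin.Base as Fin using (Fin; toℕ; fromℕ; fromℕ<; inject₁; punchOut)
open import Data.Fin.Induction using (spo-wellFounded)
import Data.Fin.Properties as Fin
open import Data.List.Base using (List; []; _∷_; map; filter; length; allFin; cartesianProduct)
import Data.List.Extrema as Extrema
open import Data.List.Membership.Propositional using (_∈_)
open import Data.List.Membership.Propositional.Properties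
  using (∈-filter⁺; ∈-filter⁻; ∈-cartesianProduct⁺; ∈-allFin; ∈-map⁺)
open import Data.List.Properties using (filter-accept; filter-none; length-map)
open import Data.List.Relation.Binary.Lex.Core using (base; this; next)
open import Data.List.Relation.Binary.Lex.NonStrict using (Lex-≤)
open import Data.List.Relation.Binary.Permutation.Propositional.Properties using (↭-length; filter-↭)
import Data.List.Relation.Unary.All as All
open import Data.List.Relation.Unary.All.Properties using (all-filter) renaming (map⁺ to All-map⁺)
open import Data.List.Relation.Unary.Any using (here; there)
import Data.List.Relation.Unary.Linked as Linked
open import Data.List.Relation.Unary.Linked.Properties using (Linked⇒All)
import Data.List.Relation.Unary.Sorted.TotalOrder as SortedTotalOrder
import Data.List.Sort as Sort
open import Data.Nat.Base as ℕ using (ℕ; zero; suc) renaming (_≤_ to _≤ℕ_)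
import Data.Nat.Properties as ℕ
open import Data.Product.Base using (∃-syntax; _×_; _,_; proj₁; proj₂)
open import Data.Sum.Base using (_⊎_; inj₁; inj₂; [_,_]′)
open import Data.Vec.Functional using (updateAt)
open import Data.Vec.Functional.Properties using (updateAt-updates; updateAt-minimal)
open import Function.Base using (_∘_; const)
open import Induction.WellFounded using (Acc; acc)
open import Level using (0ℓ)
open import Relation.Binary.Bundles using (DecTotalOrder)
open import Relation.Binary.Construct.Closure.ReflexiveTransitive using (ε; _◅_)
import Relation.Binary.Construct.On as On
open import Relation.Binary.Definitions using (tri<; tri≈; tri>)
import Relation.Binary.Properties.DecTotalOrder as DecTotalOrderProperties
open import Relation.Binary.PropositionalEquality
import Relation.Binary.Reasoning.PartialOrder as PosetReasoning
open import Relation.Nullary.Decidable using (yes; no; _×-dec_)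
open import Relation.Nullary.Negation using (¬_; contradiction)
open import Relation.Unary using (Decidable; Pred; _⊆_)

-- Order and arithmetic of the reals.

module RealProperties (ℝ : RealField) where
  open RealField ℝ
  open CommutativeRing commutativeRing public
    using (ring; +-assoc; +-comm; +-identityˡ; +-identityʳ;
           *-assoc; *-comm; *-identityˡ; *-identityʳ; distribˡ; distribʳ; zeroˡ; -‿inverseˡ)
  open DecTotalOrder decTotalOrder public
    using (totalOrder; _≟_)
    renaming (refl to ≤-refl; reflexive to ≤-reflexive; trans to ≤-trans;
              antisym to ≤-antisym; total to ≤-total)
  open DecTotalOrderProperties decTotalOrder public
    using (<-isStrictPartialOrder; <⇒≱; ≰⇒>; ≮⇒≥; <-compare)
  open RingProperties ring public using (+-cancelˡ; +-cancelʳ; -1*x≈-x; -‿involutive; ⁻¹-anti-homo‿-)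
  module ≤-Reasoning = PosetReasoning (DecTotalOrder.poset decTotalOrder)
  open ≤-Reasoning

  <-≤-trans : ∀ {x y z} → x < y → y ≤ z → x < z
  <-≤-trans {x} {y} {z} x<y y≤z = begin-strict x <⟨ x<y ⟩ y ≤⟨ y≤z ⟩ z ∎

  ≤-<-trans : ∀ {x y z} → x ≤ y → y < z → x < z
  ≤-<-trans {x} {y} {z} x≤y y<z = begin-strict x ≤⟨ x≤y ⟩ y <⟨ y<z ⟩ z ∎

  +-monoʳ-≤ : ∀ z {x y} → x ≤ y → z + x ≤ z + y
  +-monoʳ-≤ z {x} {y} x≤y = subst₂ _≤_ (+-comm x z) (+-comm y z) (+-monoˡ-≤ z x≤y)

  +-monoˡ-< : ∀ z {x y} → x < y → x + z < y + z
  +-monoˡ-< z (x≤y , x≢y) = +-monoˡ-≤ z x≤y , x≢y ∘ +-cancelʳ z _ _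

  +-monoʳ-< : ∀ z {x y} → x < y → z + x < z + y
  +-monoʳ-< z (x≤y , x≢y) = +-monoʳ-≤ z x≤y , x≢y ∘ +-cancelˡ z _ _

  +-cancelˡ-≤ : ∀ z {x y} → z + x ≤ z + y → x ≤ y
  +-cancelˡ-≤ z {x} {y} z+x≤z+y = ≮⇒≥ λ y<x → <⇒≱ (+-monoʳ-< z y<x) z+x≤z+y

  +-cancelˡ-< : ∀ z {x y} → z + x < z + y → x < y
  +-cancelˡ-< z {x} {y} z+x<z+y = ≰⇒> λ y≤x → <⇒≱ z+x<z+y (+-monoʳ-≤ z y≤x)

  x+[y-x]≡y : ∀ x y → x + (y - x) ≡ y
  x+[y-x]≡y x y = trans (+-comm x (y - x))
    (trans (+-assoc y (- x) x) (trans (cong (y +_) (-‿inverseˡ x)) (+-identityʳ y)))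

  x+y≡z⇒z-x≡y : ∀ {x y z} → x + y ≡ z → z - x ≡ y
  x+y≡z⇒z-x≡y {x} {y} {z} x+y≡z = +-cancelˡ x _ _ (trans (x+[y-x]≡y x z) (sym x+y≡z))

  x<x+y : ∀ x {y} → 0# < y → x < x + y
  x<x+y x {y} 0<y = subst (_< x + y) (+-identityʳ x) (+-monoʳ-< x 0<y)

  x≤x+y : ∀ x {y} → 0# ≤ y → x ≤ x + y
  x≤x+y x {y} 0≤y = subst (_≤ x + y) (+-identityʳ x) (+-monoʳ-≤ x 0≤y)

  x≤y⇒0≤y-x : ∀ {x y} → x ≤ y → 0# ≤ y - x
  x≤y⇒0≤y-x {x} {y} x≤y = +-cancelˡ-≤ x
    (subst₂ _≤_ (sym (+-identityʳ x)) (sym (x+[y-x]≡y x y)) x≤y)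

  *-monoʳ-≤ : ∀ {x y z} → 0# ≤ z → x ≤ y → x * z ≤ y * z
  *-monoʳ-≤ {x} {y} {z} 0≤z x≤y = begin
    x * z                ≤⟨ x≤x+y (x * z) (*-nonNegative (x≤y⇒0≤y-x x≤y) 0≤z) ⟩
    x * z + (y - x) * z  ≡⟨ distribʳ z x (y - x) ⟨
    (x + (y - x)) * z    ≡⟨ cong (_* z) (x+[y-x]≡y x y) ⟩
    y * z                ∎

  0≤1 : 0# ≤ 1#
  0≤1 with ≤-total 0# 1#
  ... | inj₁ 0≤1 = 0≤1
  -- If `1# ≤ 0#` then `- 1#` is nonnegative, and so is its square, which is `1#`.
  ... | inj₂ 1≤0 = subst (0# ≤_) (trans (-1*x≈-x (- 1#)) (-‿involutive 1#)) (*-nonNegative 0≤-1 0≤-1)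
    where
    0≤-1 : 0# ≤ - 1#
    0≤-1 = subst (0# ≤_) (+-identityˡ (- 1#)) (x≤y⇒0≤y-x 1≤0)

  0<1 : 0# < 1#
  0<1 = 0≤1 , 0≢1

  0≤ι : ∀ n → 0# ≤ ι n
  0≤ι zero    = ≤-refl
  0≤ι (suc n) = ≤-trans (0≤ι n) (subst (ι n ≤_) (+-comm (ι n) 1#) (x≤x+y (ι n) 0≤1))

  0<ι : ∀ {n} → 1 ℕ.≤ n → 0# < ι n
  0<ι {suc n} _ = <-≤-trans 0<1 (x≤x+y 1# (0≤ι n))

  ι-+ : ∀ m n → ι (m ℕ.+ n) ≡ ι m + ι n
  ι-+ zero    n = sym (+-identityˡ (ι n))
  ι-+ (suc m) n = trans (cong (1# +_) (ι-+ m n)) (sym (+-assoc 1# (ι m) (ι n)))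

  ι-+-* : ∀ a m n p → a + ι (m ℕ.+ n) * p ≡ a + ι m * p + ι n * p
  ι-+-* a m n p = trans
    (cong (a +_) (trans (cong (_* p) (ι-+ m n)) (distribʳ p (ι m) (ι n))))
    (sym (+-assoc a _ _))

  ι-suc-* : ∀ n p → ι (suc n) * p ≡ p + ι n * p
  ι-suc-* n p = trans (distribʳ p 1# (ι n)) (cong (_+ ι n * p) (*-identityˡ p))

  ι-1-* : ∀ p → ι 1 * p ≡ p
  ι-1-* p = trans (ι-suc-* 0 p) (trans (cong (p +_) (zeroˡ p)) (+-identityʳ p))

  a+0*p≡a : ∀ a p → a + ι 0 * p ≡ a
  a+0*p≡a a p = trans (cong (a +_) (zeroˡ p)) (+-identityʳ a)

  ι-mono-≤ : ∀ {m n} → m ℕ.≤ n → ι m ≤ ι n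
  ι-mono-≤ {n = n} ℕ.z≤n   = 0≤ι n
  ι-mono-≤ (ℕ.s≤s m≤n) = +-monoʳ-≤ 1# (ι-mono-≤ m≤n)

  ι-*-≥ : ∀ {n p} → 1 ℕ.≤ n → 0# ≤ p → p ≤ ι n * p
  ι-*-≥ {suc n} {p} _ 0≤p = subst (p ≤_) (sym (ι-suc-* n p)) (x≤x+y p (*-nonNegative (0≤ι n) 0≤p))

  ι*1/ : ∀ {n} → 1 ℕ.≤ n → ι n * (1# / n) ≡ 1#
  ι*1/ {n} 1≤n = trans (cong (ι n *_) (*-identityˡ _)) (⁻¹-inverseʳ (ι n) (≢-sym (proj₂ (0<ι 1≤n))))

  0<1/ : ∀ {n} → 1 ℕ.≤ n → 0# < 1# / n
  0<1/ {n} 1≤n = ≰⇒> λ 1/n≤0 → <⇒≱ 0<1 (begin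
    1#               ≡⟨ ι*1/ 1≤n ⟨
    ι n * (1# / n)   ≡⟨ *-comm _ _ ⟩
    (1# / n) * ι n   ≤⟨ *-monoʳ-≤ (0≤ι n) 1/n≤0 ⟩
    0# * ι n         ≡⟨ zeroˡ (ι n) ⟩
    0#               ∎)

  *-/-cancel : ∀ {n} → 1 ℕ.≤ n → ∀ x → (ι n * x) / n ≡ x
  *-/-cancel {n} 1≤n x = trans (cong (_/ n) (*-comm (ι n) x)) (trans (*-assoc x (ι n) _)
    (trans (cong (x *_) (⁻¹-inverseʳ (ι n) (≢-sym (proj₂ (0<ι 1≤n))))) (*-identityʳ x)))

  dense : ∀ {x y} → x < y → ∃[ z ] x < z × z < y
  dense {x} {y} x<y = x + δ , x<x+y x 0<δ , subst (x + δ <_) x+δ+δ≡y (x<x+y (x + δ) 0<δ)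
    where
    ½ = 1# / 2
    δ = (y - x) * ½
    ½+½≡1 : ½ + ½ ≡ 1#
    ½+½≡1 = trans (cong (½ +_) (sym (ι-1-* ½))) (trans (sym (ι-suc-* 1 ½)) (ι*1/ {2} (ℕ.s≤s ℕ.z≤n)))
    x+δ+δ≡y : x + δ + δ ≡ y
    x+δ+δ≡y = begin-equality
      x + δ + δ              ≡⟨ +-assoc x δ δ ⟩
      x + (δ + δ)            ≡⟨ cong (x +_) (distribˡ (y - x) ½ ½) ⟨
      x + (y - x) * (½ + ½)  ≡⟨ cong (λ z → x + (y - x) * z) ½+½≡1 ⟩
      x + (y - x) * 1#       ≡⟨ cong (x +_) (*-identityʳ (y - x)) ⟩
      x + (y - x)            ≡⟨ x+[y-x]≡y x y ⟩
      y                      ∎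
    δ≢0 : δ ≢ 0#
    δ≢0 δ≡0 = proj₂ x<y (begin-equality
      x              ≡⟨ +-identityʳ x ⟨
      x + 0#         ≡⟨ +-identityʳ (x + 0#) ⟨
      x + 0# + 0#    ≡⟨ cong (λ z → x + z + z) δ≡0 ⟨
      x + δ + δ      ≡⟨ x+δ+δ≡y ⟩
      y              ∎)
    0<δ : 0# < δ
    0<δ = *-nonNegative (x≤y⇒0≤y-x (proj₁ x<y)) (proj₁ (0<1/ {2} (ℕ.s≤s ℕ.z≤n))) , ≢-sym δ≢0

  -- The additive form lets later equations and inequalities between contrasts be settled by
  -- cancellation, without looking at the sign of a difference.
  ∣-∣-≥ : ∀ {x y} → y ≤ x → y + ∣ x - y ∣ ≡ x
  ∣-∣-≥ {x} {y} y≤x with 0# ≤? x - y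
  ... | yes _ = x+[y-x]≡y y x
  ... | no ≰  = contradiction (x≤y⇒0≤y-x y≤x) ≰

  ∣-∣-≤ : ∀ {x y} → x ≤ y → x + ∣ x - y ∣ ≡ y
  ∣-∣-≤ {x} {y} x≤y with 0# ≤? x - y
  ... | no _      = trans (cong (x +_) (⁻¹-anti-homo‿- x y)) (x+[y-x]≡y x y)
  ... | yes 0≤x-y = trans (cong (λ z → z + (x - y)) x≡y) (trans (x+[y-x]≡y y x) x≡y)
    where
    x≡y : x ≡ y
    x≡y = ≤-antisym x≤y (subst (y ≤_) (x+[y-x]≡y y x) (x≤x+y y 0≤x-y))

  ∣-∣-comm : ∀ x y → ∣ x - y ∣ ≡ ∣ y - x ∣
  ∣-∣-comm x y with ≤-total x y
  ... | inj₁ x≤y = +-cancelˡ x _ _ (trans (∣-∣-≤ x≤y) (sym (∣-∣-≥ x≤y)))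
  ... | inj₂ y≤x = +-cancelˡ y _ _ (trans (∣-∣-≥ y≤x) (sym (∣-∣-≤ y≤x)))

  ≤-∣-∣ : ∀ {x y p} → 0# ≤ p → x + p ≤ y → p ≤ ∣ x - y ∣
  ≤-∣-∣ {x} {y} {p} 0≤p x+p≤y =
    +-cancelˡ-≤ x (subst (x + p ≤_) (sym (∣-∣-≤ (≤-trans (x≤x+y x 0≤p) x+p≤y))) x+p≤y)

  <-∣-∣ : ∀ {x y p} → 0# ≤ p → x + p < y → p < ∣ x - y ∣
  <-∣-∣ {x} {y} {p} 0≤p x+p<y =
    +-cancelˡ-< x (subst (x + p <_) (sym (∣-∣-≤ (≤-trans (x≤x+y x 0≤p) (proj₁ x+p<y)))) x+p<y)

-- Comparing the sizes of filtered lists.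

module _ {A B : Set} {P Q : Pred B 0ℓ} (P? : Decidable P) (Q? : Decidable Q) (f g : A → B) where
  private
    #f #g : List A → ℕ
    #f xs = length (filter P? (map f xs))
    #g xs = length (filter Q? (map g xs))

  filter-map-mono-≤ : ∀ xs → (∀ {x} → x ∈ xs → P (f x) → Q (g x)) → #f xs ℕ.≤ #g xs
  filter-map-mono-≤ []       _   = ℕ.z≤n
  filter-map-mono-≤ (x ∷ xs) P⇒Q with P? (f x) | Q? (g x) | filter-map-mono-≤ xs (P⇒Q ∘ there)
  ... | yes p | yes _ | #≤ = ℕ.s≤s #≤
  ... | yes p | no ¬q | _  = contradiction (P⇒Q (here refl) p) ¬q
  ... | no _  | yes _ | #≤ = ℕ.m≤n⇒m≤1+n #≤
  ... | no _  | no _  | #≤ = #≤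

  filter-map-mono-< : ∀ {x} xs → (∀ {x} → x ∈ xs → P (f x) → Q (g x)) →
                      x ∈ xs → ¬ P (f x) → Q (g x) → #f xs ℕ.< #g xs
  filter-map-mono-< (x ∷ xs) P⇒Q (here refl) ¬p q with P? (f x) | Q? (g x)
  ... | yes p | _     = contradiction p ¬p
  ... | no _  | yes _ = ℕ.s≤s (filter-map-mono-≤ xs (P⇒Q ∘ there))
  ... | no _  | no ¬q = contradiction q ¬q
  filter-map-mono-< (x ∷ xs) P⇒Q (there y∈) ¬p q
    with P? (f x) | Q? (g x) | filter-map-mono-< xs (P⇒Q ∘ there) y∈ ¬p q
  ... | yes p | yes _ | #< = ℕ.s≤s #<
  ... | yes p | no ¬q | _  = contradiction (P⇒Q (here refl) p) ¬q
  ... | no _  | yes _ | #< = ℕ.m≤n⇒m≤1+n #<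
  ... | no _  | no _  | #< = #<

-- Lexicographic order of sorted lists through counting.

module SortedLists (ℝ : RealField) where
  open RealField ℝ
  open RealProperties ℝ
  open SortedTotalOrder totalOrder using (Sorted)
  open Sort decTotalOrder using (sort; sort-↭; sort-↗)

  #≤ : Carrier → List Carrier → ℕ
  #≤ p xs = length (filter (_≤? p) xs)

  #≤-none : ∀ {p x xs} → Sorted (x ∷ xs) → p < x → #≤ p (x ∷ xs) ≡ 0
  #≤-none {p} {x} xs↗ p<x = cong length (filter-none (_≤? p)
    (All.map (λ x≤y y≤p → <⇒≱ p<x (≤-trans x≤y y≤p)) (Linked⇒All ≤-trans ≤-refl xs↗)))

  -- Generic in `R` because the lexicographic induction carries both `≤` and `<` past a common head.
  #≤-cong-∷ : ∀ p x {xs ys} {R : ℕ → ℕ → Set} → (∀ {m n} → R m n → R (suc m) (suc n)) →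
              R (#≤ p xs) (#≤ p ys) → R (#≤ p (x ∷ xs)) (#≤ p (x ∷ ys))
  #≤-cong-∷ p x R-suc r with x ≤? p
  ... | yes _ = R-suc r
  ... | no _  = r

  #≤-head : ∀ x xs → 0 ℕ.< #≤ x (x ∷ xs)
  #≤-head x xs = subst (λ ys → 0 ℕ.< length ys) (sym (filter-accept (_≤? x) ≤-refl)) (ℕ.s≤s ℕ.z≤n)

  -- At the first difference `x < y`, and all later entries of the sorted list `ys` are at least
  -- `y`. Either `p ≤ x`, and nothing in `ys` from there on is counted, or `t = x` counts entries of
  -- `xs` only from there on. The length premise excludes that `xs` is a proper prefix of `ys`.
  Lex-≤⇒#≤ : ∀ p {xs ys} → Lex-≤ _≡_ _≤_ xs ys → Sorted ys → length ys ℕ.≤ length xs →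
             #≤ p ys ℕ.≤ #≤ p xs ⊎ ∃[ t ] t < p × #≤ t ys ℕ.< #≤ t xs
  Lex-≤⇒#≤ p (base _) _ _ = inj₁ ℕ.z≤n
  Lex-≤⇒#≤ p (this {x} {xs} {y} {ys} x<y) ys↗ _ with p ≤? x
  ... | yes p≤x = inj₁ (subst (ℕ._≤ _) (sym (#≤-none ys↗ (≤-<-trans p≤x x<y))) ℕ.z≤n)
  ... | no p≰x  = inj₂ (x , ≰⇒> p≰x , subst (ℕ._< _) (sym (#≤-none ys↗ x<y)) (#≤-head x xs))
  Lex-≤⇒#≤ p (next {x} {xs} {_} {ys} refl xs≤ys) ys↗ (ℕ.s≤s |ys|≤|xs|)
    with Lex-≤⇒#≤ p xs≤ys (Linked.tail ys↗) |ys|≤|xs|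
  ... | inj₁ #≤#             = inj₁ (#≤-cong-∷ p x {ys} {xs} {ℕ._≤_} ℕ.s≤s #≤#)
  ... | inj₂ (t , t<p , #<#) = inj₂ (t , t<p , #≤-cong-∷ t x {ys} {xs} {ℕ._<_} ℕ.s≤s #<#)

  #≤-sort : ∀ p xs → #≤ p (sort xs) ≡ #≤ p xs
  #≤-sort p xs = ↭-length (filter-↭ (_≤? p) (sort-↭ xs))

  length-sort-map : ∀ {A : Set} (g : A → Carrier) xs → length (sort (map g xs)) ≡ length xs
  length-sort-map g xs = trans (↭-length (sort-↭ (map g xs))) (length-map g xs)

  -- If some g x ≤ p rose above p, then h would have fewer values ≤ p than g and
  -- no more values ≤ t for any t < p, so that sort (map h xs) would be the larger.
  sort-map-Lex-≤ : ∀ {A : Set} {g h : A → Carrier} xs p →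
    Lex-≤ _≡_ _≤_ (sort (map h xs)) (sort (map g xs)) →
    (∀ {x} → x ∈ xs → h x ≤ p → g x ≤ h x) →
    ∀ {x} → x ∈ xs → g x ≤ p → h x ≤ p
  sort-map-Lex-≤ {g = g} {h} xs p h≤g below {x} x∈xs gx≤p with h x ≤? p
  ... | yes hx≤p = hx≤p
  ... | no hx≰p with Lex-≤⇒#≤ p h≤g (sort-↗ _)
    (ℕ.≤-reflexive (trans (length-sort-map g xs) (sym (length-sort-map h xs))))
  ...   | inj₁ #≤# = contradiction (subst₂ ℕ._≤_ (#≤-sort p _) (#≤-sort p _) #≤#)
    (ℕ.<⇒≱ (filter-map-mono-< (_≤? p) (_≤? p) h g xs
      (λ x∈ hx≤p → ≤-trans (below x∈ hx≤p) hx≤p) x∈xs hx≰p gx≤p))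
  ...   | inj₂ (t , t<p , #<#) = contradiction
    (filter-map-mono-≤ (_≤? t) (_≤? t) h g xs
      (λ x∈ hx≤t → ≤-trans (below x∈ (≤-trans hx≤t (proj₁ t<p))) hx≤t))
    (ℕ.<⇒≱ (subst₂ ℕ._<_ (#≤-sort t _) (#≤-sort t _) #<#))

-- Cells of the grid with step `h`.

module Cells (ℝ : RealField) where
  open RealField ℝ
  open RealProperties ℝ

  -- With the i-th grid point avoided, the cells to its left are half-open on the
  -- right and the cells to its right are half-open on the left.
  record InCell (h : Carrier) (i j : ℕ) (x : Carrier) : Set where
    field
      lower   : ι j * h ≤ x
      upper   : x ≤ ι (suc j) * h
      lower-< : i ℕ.≤ j → ι j * h < x
      upper-< : j ℕ.< i → x < ι (suc j) * h

  -- A search downwards through the first `n` cells. A grid point `ι n * h` goes to the cell on its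
  -- right if `n < i` and to the one on its left if `i < n`; the case `n ≡ i` is excluded. The last
  -- premise is `upper-<` for the topmost cell, because `j < i` with `n = suc j` is `n ≤ i`.
  cell : ∀ {h i x} n → 0# ≤ x → x ≢ ι i * h → x ≤ ι n * h → (n ℕ.≤ i → x < ι n * h) →
         ∃[ j ] j ℕ.< n × InCell h i j x
  cell {h} {i} {x} zero 0≤x _ _ x<0 =
    contradiction 0≤x (<⇒≱ (subst (x <_) (zeroˡ h) (x<0 ℕ.z≤n)))
  cell {h} {i} {x} (suc n) 0≤x x≢ih x≤ x< with <-compare x (ι n * h)
  ... | tri> _ _ nh<x = n , ℕ.≤-refl ,
    record { lower = proj₁ nh<x ; upper = x≤ ; lower-< = const nh<x ; upper-< = x< }
  ... | tri< x<nh _ _ with j , j<n , c ← cell n 0≤x x≢ih (proj₁ x<nh) (const x<nh) =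
    j , ℕ.m≤n⇒m≤1+n j<n , c
  ... | tri≈ _ x≡nh _ with n ℕ.<? i
  ...   | yes n<i = n , ℕ.≤-refl , record
    { lower = ≤-reflexive (sym x≡nh) ; upper = x≤
    ; lower-< = λ i≤n → contradiction n<i (ℕ.≤⇒≯ i≤n) ; upper-< = x< }
  ...   | no n≮i with j , j<n , c ← cell n 0≤x x≢ih (≤-reflexive x≡nh) (λ n≤i →
            contradiction (trans x≡nh (cong (λ m → ι m * h) (ℕ.≤-antisym n≤i (ℕ.≮⇒≥ n≮i)))) x≢ih) =
    j , ℕ.m≤n⇒m≤1+n j<n , c

  -- A cell has length `h` and omits one of its ends, the right one if `j < i` and the left one
  -- otherwise. This makes the inequality strict.
  InCell⇒< : ∀ {h i j x y} → InCell h i j x → InCell h i j y → y < x + h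
  InCell⇒< {h} {i} {j} {x} {y} cx cy with j ℕ.<? i
  ... | yes j<i = begin-strict
    y               <⟨ InCell.upper-< cy j<i ⟩
    ι (suc j) * h   ≡⟨ ι-suc-* j h ⟩
    h + ι j * h     ≤⟨ +-monoʳ-≤ h (InCell.lower cx) ⟩
    h + x           ≡⟨ +-comm h x ⟩
    x + h           ∎
    where open ≤-Reasoning
  ... | no j≮i = begin-strict
    y               ≤⟨ InCell.upper cy ⟩
    ι (suc j) * h   ≡⟨ ι-suc-* j h ⟩
    h + ι j * h     <⟨ +-monoʳ-< h (InCell.lower-< cx (ℕ.≮⇒≥ j≮i)) ⟩
    h + x           ≡⟨ +-comm h x ⟩
    x + h           ∎
    where open ≤-Reasoning

  InCell⇒∣-∣< : ∀ {h i j x y} → InCell h i j x → InCell h i j y → ∣ x - y ∣ < h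
  InCell⇒∣-∣< {h} {i} {j} {x} {y} cx cy with ≤-total x y
  ... | inj₁ x≤y = +-cancelˡ-< x (subst (_< x + h) (sym (∣-∣-≤ x≤y)) (InCell⇒< cx cy))
  ... | inj₂ y≤x = +-cancelˡ-< y (subst (_< y + h) (sym (∣-∣-≥ y≤x)) (InCell⇒< cy cx))

-- Colourings and connectedness.

module Colourings (G : Graph) where
  open Graph G hiding (sym)

  chromatic⇒surjective : ∀ {k} → HasChromaticNumber (suc k) →
    (col : Colorable (suc k)) → ∀ i → ∃[ v ] proj₁ col v ≡ i
  chromatic⇒surjective {k} (_ , least) (c , proper) i with Fin.any? (λ v → c v Fin.≟ i)
  ... | yes hit = hit
  ... | no miss = contradiction (least k (punched , punched-proper)) ℕ.1+n≰n
    where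
    i≢c : ∀ v → i ≢ c v
    i≢c v i≡cv = miss (v , sym i≡cv)
    punched : Vertex → Fin k
    punched v = punchOut (i≢c v)
    punched-proper : ∀ {u v} → u ~ v → punched u ≢ punched v
    punched-proper u~v = proper u~v ∘ Fin.punchOut-injective (i≢c _) (i≢c _)

  neighbour : Connected → ∀ {u v} → u ≢ v → ∃[ w ] u ~ w
  neighbour connected {u} {v} u≢v with connected u v
  ... | ε       = contradiction refl u≢v
  ... | u~w ◅ _ = _ , u~w

-- Contrasts of at least `1# / k` and the grid values.

module Greyscales (ℝ : RealField) (G : Graph) where
  open Contrast ℝ
  open RealProperties ℝ
  open SortedLists ℝ
  open Cells ℝ
  open Colourings G
  open Graph G renaming (sym to ~-sym; irrefl to ~-irrefl)

  contrast : (Vertex → Carrier) → Vertex × Vertex → Carrier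
  contrast f (u , v) = ∣ f u - f v ∣

  edge : Decidable {A = Vertex × Vertex} λ (u , v) → u Fin.< v × u ~ v
  edge (u , v) = (u Fin.<? v) ×-dec (u ~? v)

  edges⁺ : ∀ {u v} → u Fin.< v → u ~ v → (u , v) ∈ edges
  edges⁺ u<v u~v = ∈-filter⁺ edge (∈-cartesianProduct⁺ (∈-allFin _) (∈-allFin _)) (u<v , u~v)

  edges⁻ : ∀ {e} → e ∈ edges → proj₁ e ~ proj₂ e
  edges⁻ e∈ = proj₂ (proj₂ (∈-filter⁻ edge {xs = cartesianProduct (allFin order) (allFin order)} e∈))

  -- This is `sort-map-Lex-≤` on the edge list, with the maximality of `f` supplying the
  -- lexicographic comparison. An edge is listed only with its smaller endpoint first, so the other
  -- orientation is reached through the symmetry of the contrast.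
  no-improvement : ∀ {f g} → IsMaximumContrastGreyscale G f → IsGreyscale G g → ∀ p →
    (∀ {u v} → u ~ v → ∣ g u - g v ∣ ≤ p → ∣ f u - f v ∣ ≤ ∣ g u - g v ∣) →
    ∀ {u v} → u ~ v → ∣ f u - f v ∣ ≤ p → ∣ g u - g v ∣ ≤ p
  no-improvement {f} {g} (_ , max) greyscale p hyp {u} {v} u~v fuv≤p with Fin.<-cmp u v
  ... | tri< u<v _ _ =
    sort-map-Lex-≤ {g = contrast f} {h = contrast g} edges p (max g greyscale)
      (hyp ∘ edges⁻) (edges⁺ u<v u~v) fuv≤p
  ... | tri≈ _ u≡v _ = contradiction u~v (~-irrefl u≡v)
  ... | tri> _ _ v<u = subst (_≤ p) (∣-∣-comm (g v) (g u))
    (sort-map-Lex-≤ {g = contrast f} {h = contrast g} edges p (max g greyscale)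
      (hyp ∘ edges⁻) (edges⁺ v<u (~-sym u~v)) (subst (_≤ p) (∣-∣-comm (f u) (f v)) fuv≤p))

  module _ {k : ℕ} (1≤k : 1 ℕ.≤ k) (chromatic : HasChromaticNumber (suc k)) where

    private
      h : Carrier
      h = 1# / k

      0<h : 0# < h
      0<h = 0<1/ 1≤k

    colouring : Colorable (suc k)
    colouring = proj₁ chromatic

    shade : Vertex → Carrier
    shade v = ι (toℕ (proj₁ colouring v)) * h

    -- The values `0#` and `1#` are attained because a colouring with the least number of colours
    -- uses the first and the last of them.
    shade-greyscale : IsGreyscale G shade
    shade-greyscale = (λ v → 0≤ι*h (toℕ (c v)) , ≤1 v) , (v₀ , shade₀) , (v₁ , shade₁)
      where
      c : Vertex → Fin (suc k)
      c = proj₁ colouring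
      0≤ι*h : ∀ n → 0# ≤ ι n * h
      0≤ι*h n = *-nonNegative (0≤ι n) (proj₁ 0<h)
      ≤1 : ∀ v → shade v ≤ 1#
      ≤1 v = subst (shade v ≤_) (ι*1/ 1≤k) (*-monoʳ-≤ (proj₁ 0<h) (ι-mono-≤ (Fin.toℕ≤pred[n] (c v))))
      surj = chromatic⇒surjective chromatic colouring
      v₀ = proj₁ (surj Fin.zero)
      v₁ = proj₁ (surj (fromℕ k))
      shade₀ : shade v₀ ≡ 0#
      shade₀ = trans (cong (λ i → ι (toℕ i) * h) (proj₂ (surj Fin.zero))) (zeroˡ h)
      shade₁ : shade v₁ ≡ 1#
      shade₁ = trans (cong (λ i → ι (toℕ i) * h) (proj₂ (surj (fromℕ k))))
        (trans (cong (λ n → ι n * h) (Fin.toℕ-fromℕ k)) (ι*1/ 1≤k))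

    ι-separated : ∀ {m n} → m ℕ.< n → h ≤ ∣ ι m * h - ι n * h ∣
    ι-separated {m} {n} m<n = ≤-∣-∣ (proj₁ 0<h) (subst (_≤ ι n * h)
      (trans (ι-suc-* m h) (+-comm h (ι m * h))) (*-monoʳ-≤ (proj₁ 0<h) (ι-mono-≤ m<n)))

    shade-contrast : ∀ {u v} → u ~ v → h ≤ ∣ shade u - shade v ∣
    shade-contrast {u} {v} u~v with Fin.<-cmp (proj₁ colouring u) (proj₁ colouring v)
    ... | tri< cu<cv _ _ = ι-separated cu<cv
    ... | tri≈ _ cu≡cv _ = contradiction cu≡cv (proj₂ colouring u~v)
    ... | tri> _ _ cv<cu = subst (h ≤_) (∣-∣-comm (shade v) (shade u)) (ι-separated cv<cu)

    -- Take the contrast of an offending edge as threshold. It is below `h`, so no contrast of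
    -- `shade` reaches down to it: the premise of `no-improvement` is vacuous and its conclusion
    -- absurd.
    maximum⇒h≤contrast : ∀ {f} → IsMaximumContrastGreyscale G f →
      ∀ {u v} → u ~ v → h ≤ ∣ f u - f v ∣
    maximum⇒h≤contrast {f} f-max {u} {v} u~v = ≮⇒≥ λ fuv<h →
      <⇒≱ (<-≤-trans fuv<h (shade-contrast u~v))
        (no-improvement f-max shade-greyscale ∣ f u - f v ∣
          (λ u'~v' s≤fuv → contradiction (≤-trans (shade-contrast u'~v') s≤fuv) (<⇒≱ fuv<h))
          u~v ≤-refl)

    -- If the grid point is missed, sending a vertex to its cell is a proper colouring with `k`
    -- colours: values in one cell differ by less than `h`, those of adjacent vertices by at least
    -- `h`.
    grid⊆Im : ∀ {f} → IsGreyscale G f → (∀ {u v} → u ~ v → h ≤ ∣ f u - f v ∣) →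
      ∀ {i} → i ℕ.≤ k → Im G f (ι i * h)
    grid⊆Im {f} (unit , _) h≤contrast {i} i≤k with Fin.any? (λ v → f v ≟ ι i * h)
    ... | yes hit = hit
    ... | no miss = contradiction (proj₂ chromatic k (cellOf , cellOf-proper)) ℕ.1+n≰n
      where
      located : ∀ v → ∃[ j ] j ℕ.< k × InCell h i j (f v)
      located v = cell k (proj₁ (unit v)) (λ fv≡ → miss (v , fv≡)) fv≤kh
        -- Here `k ≤ i` forces `i ≡ k`, so the missed value is `1#` itself and the bound is strict.
        λ k≤i → fv≤kh , λ fv≡ → miss (v , trans fv≡ (cong (λ n → ι n * h) (ℕ.≤-antisym k≤i i≤k)))
        where
        fv≤kh : f v ≤ ι k * h
        fv≤kh = subst (f v ≤_) (sym (ι*1/ 1≤k)) (proj₂ (unit v))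
      cellOf : Vertex → Fin k
      cellOf v = fromℕ< (proj₁ (proj₂ (located v)))
      cellOf-proper : ∀ {u v} → u ~ v → cellOf u ≢ cellOf v
      cellOf-proper {u} {v} u~v same with located u | located v
      ... | j , j<k , cu | j' , j'<k , cv with refl ← Fin.fromℕ<-injective j j' j<k j'<k same =
        <⇒≱ (InCell⇒∣-∣< cu cv) (h≤contrast u~v)

-- The smallest contrast at a vertex.

module MaximumContrast
  (ℝ : RealField) (G : Graph) (k : ℕ) (2≤k : 2 ℕ.≤ k)
  (connected : Graph.Connected G) (chromatic : Graph.HasChromaticNumber G (suc k))
  (f : Graph.Vertex G → RealField.Carrier ℝ)
  (f-max : Contrast.IsMaximumContrastGreyscale ℝ G f) where
  open Contrast ℝ
  open RealProperties ℝ
  open Colourings G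
  open Greyscales ℝ G
  open Extrema totalOrder
  open Graph G renaming (sym to ~-sym; irrefl to ~-irrefl)

  private
    1≤k : 1 ℕ.≤ k
    1≤k = ℕ.≤-trans (ℕ.n≤1+n 1) 2≤k

    h : Carrier
    h = 1# / k

    0<h : 0# < h
    0<h = 0<1/ 1≤k

    greyscale : IsGreyscale G f
    greyscale = proj₁ f-max

    unit : ∀ v → UnitInterval (f v)
    unit = proj₁ greyscale

  h≤contrast : ∀ {u v} → u ~ v → h ≤ ∣ f u - f v ∣
  h≤contrast = maximum⇒h≤contrast 1≤k chromatic f-max

  abstract
    -- Both `0#` and `1#` occur as shades, so some vertex differs from `v`, and a path to it starts
    -- with an edge at `v`. The neighbour found is the default candidate in `argmin`.
    adjacent : ∀ v → ∃[ u ] v ~ u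
    adjacent v with greyscale | f v ≟ 0#
    ... | _ , _ , (v₁ , fv₁≡1) | yes fv≡0 =
      neighbour connected λ v≡v₁ → 0≢1 (trans (sym fv≡0) (trans (cong f v≡v₁) fv₁≡1))
    ... | _ , (v₀ , fv₀≡0) , _ | no fv≢0 =
      neighbour connected λ v≡v₀ → fv≢0 (trans (cong f v≡v₀) fv₀≡0)

    neighbours : Vertex → List Vertex
    neighbours v = filter (v ~?_) (allFin order)

    nearest : Vertex → Vertex
    nearest v = argmin (λ u → ∣ f v - f u ∣) (proj₁ (adjacent v)) (neighbours v)

    minContrast : Vertex → Carrier
    minContrast v = ∣ f v - f (nearest v) ∣

    nearest-adjacent : ∀ v → v ~ nearest v
    nearest-adjacent v = argmin-all _ (proj₂ (adjacent v)) (all-filter (v ~?_) (allFin order))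

    minContrast-≤ : ∀ {u v} → v ~ u → minContrast v ≤ ∣ f v - f u ∣
    minContrast-≤ {u} {v} v~u = All.lookup (f[argmin]≤f[xs] (proj₁ (adjacent v)) (neighbours v))
      (∈-filter⁺ (v ~?_) (∈-allFin u) v~u)

    -- Definitional inside the `abstract` block; outside, where `minContrast` does not unfold, this
    -- ties it to an actual edge.
    minContrast-attained : ∀ v → ∣ f v - f (nearest v) ∣ ≡ minContrast v
    minContrast-attained v = refl

  h≤minContrast : ∀ v → h ≤ minContrast v
  h≤minContrast v = subst (h ≤_) (minContrast-attained v) (h≤contrast (nearest-adjacent v))

  0<minContrast : ∀ v → 0# < minContrast v
  0<minContrast v = <-≤-trans 0<h (h≤minContrast v)

  0≤minContrast : ∀ v → 0# ≤ minContrast v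
  0≤minContrast v = proj₁ (0<minContrast v)

  minContrast-≤-above : ∀ {u v} → v ~ u → f v ≤ f u → f v + minContrast v ≤ f u
  minContrast-≤-above {u} {v} v~u fv≤fu =
    subst (f v + minContrast v ≤_) (∣-∣-≤ fv≤fu) (+-monoʳ-≤ (f v) (minContrast-≤ v~u))

  minContrast-≤-below : ∀ {u v} → v ~ u → f u ≤ f v → f u + minContrast v ≤ f v
  minContrast-≤-below {u} {v} v~u fu≤fv =
    subst (f u + minContrast v ≤_) (∣-∣-≥ fu≤fv) (+-monoʳ-≤ (f u) (minContrast-≤ v~u))

  -- Tight neighbours, by moving a single shade.

  Inner : Vertex → Set
  Inner v = f v ≢ 0# × f v ≢ 1#

  extreme-or-inner : ∀ v → (f v ≡ 0# ⊎ f v ≡ 1#) ⊎ Inner v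
  extreme-or-inner v with f v ≟ 0# | f v ≟ 1#
  ... | yes fv≡0 | _        = inj₁ (inj₁ fv≡0)
  ... | no _     | yes fv≡1 = inj₁ (inj₂ fv≡1)
  ... | no fv≢0  | no fv≢1  = inj₂ (fv≢0 , fv≢1)

  -- Give `v` the shade `x` and change nothing else. Since `v` is inner, `0#` and `1#` are still
  -- attained elsewhere. All edges at `v` rise above `minContrast v` and the others keep their
  -- contrast, so the edge to `nearest v` contradicts `no-improvement` at this threshold.
  no-better-shade : ∀ {v x} → Inner v → UnitInterval x →
    ¬ (∀ {u} → v ~ u → minContrast v < ∣ x - f u ∣)
  no-better-shade {v} {x} (fv≢0 , fv≢1) x∈ better =
    <⇒≱ (g-at-v (nearest-adjacent v))
      (no-improvement f-max g-greyscale (minContrast v) hyp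
        (nearest-adjacent v) (≤-reflexive (minContrast-attained v)))
    where
    g : Vertex → Carrier
    g = updateAt f v (const x)
    gv≡x : g v ≡ x
    gv≡x = updateAt-updates v f
    g≡f : ∀ {u} → u ≢ v → g u ≡ f u
    g≡f = updateAt-minimal _ v f
    g-unit : ∀ u → UnitInterval (g u)
    g-unit u with u Fin.≟ v
    ... | yes refl = subst UnitInterval (sym gv≡x) x∈
    ... | no u≢v   = subst UnitInterval (sym (g≡f u≢v)) (unit u)
    keep : ∀ {y} → f v ≢ y → Im G f y → Im G g y
    keep fv≢y (u , fu≡y) = u , trans (g≡f λ u≡v → fv≢y (trans (cong f (sym u≡v)) fu≡y)) fu≡y
    g-greyscale : IsGreyscale G g
    g-greyscale = g-unit , keep fv≢0 (proj₁ (proj₂ greyscale)) , keep fv≢1 (proj₂ (proj₂ greyscale))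
    g-at-v : ∀ {u} → v ~ u → minContrast v < ∣ g v - g u ∣
    g-at-v {u} v~u = subst₂ (λ a b → minContrast v < ∣ a - b ∣) (sym gv≡x)
      (sym (g≡f (λ u≡v → ~-irrefl (sym u≡v) v~u))) (better v~u)
    hyp : ∀ {u w} → u ~ w → ∣ g u - g w ∣ ≤ minContrast v → ∣ f u - f w ∣ ≤ ∣ g u - g w ∣
    hyp {u} {w} u~w small with u Fin.≟ v | w Fin.≟ v
    ... | yes refl | _        = contradiction small (<⇒≱ (g-at-v u~w))
    ... | no _     | yes refl = contradiction (subst (_≤ minContrast v) (∣-∣-comm (g u) (g v)) small)
                                              (<⇒≱ (g-at-v (~-sym u~w)))
    ... | no u≢v   | no w≢v   = ≤-reflexive (cong₂ (λ a b → ∣ a - b ∣) (sym (g≡f u≢v)) (sym (g≡f w≢v)))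

  -- Without such a neighbour, `v` can be darkened slightly: every lower neighbour leaves some
  -- slack, and upper neighbours only get further away. All contrasts at `v` then exceed
  -- `minContrast v`.
  tight-below : ∀ {v} → Inner v → ∃[ u ] v ~ u × f u + minContrast v ≡ f v
  tight-below {v} inner@(fv≢0 , _) with Fin.any? (λ u → (v ~? u) ×-dec (f u + minContrast v ≟ f v))
  ... | yes tight = tight
  ... | no ¬tight = contradiction (λ {u} → better {u})
        (no-better-shade inner
          (≤-trans (⊥≤max 0# bounds) (proj₁ max<x) , ≤-trans (proj₁ x<fv) (proj₂ (unit v))))
    where
    p = minContrast v
    below? : Decidable λ u → v ~ u × f u ≤ f v
    below? u = (v ~? u) ×-dec (f u ≤? f v)
    -- The new shade lies strictly between the maximum of these bounds and `f v`. The default `0#`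
    -- of the maximum keeps it in the unit interval, even if there is no lower neighbour.
    bounds = map (λ u → f u + p) (filter below? (allFin order))
    bounds< : All.All (_< f v) bounds
    bounds< = All-map⁺ (All.map
      (λ (v~u , fu≤fv) → minContrast-≤-below v~u fu≤fv , λ fu+p≡fv → ¬tight (_ , v~u , fu+p≡fv))
      (all-filter below? (allFin order)))
    max<fv : max 0# bounds < f v
    max<fv = max<v⁺ (proj₁ (unit v) , fv≢0 ∘ sym) bounds<
    x = proj₁ (dense max<fv)
    max<x = proj₁ (proj₂ (dense max<fv))
    x<fv = proj₂ (proj₂ (dense max<fv))
    better : ∀ {u} → v ~ u → p < ∣ x - f u ∣
    better {u} v~u with f u ≤? f v
    ... | yes fu≤fv = subst (p <_) (∣-∣-comm (f u) x) (<-∣-∣ (0≤minContrast v) (≤-<-trans fu+p≤max max<x))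
      where
      fu+p≤max : f u + p ≤ max 0# bounds
      fu+p≤max = All.lookup (xs≤max 0# bounds)
        (∈-map⁺ (λ u → f u + p) (∈-filter⁺ below? (∈-allFin u) (v~u , fu≤fv)))
    ... | no fu≰fv = <-∣-∣ (0≤minContrast v)
      (<-≤-trans (+-monoˡ-< p x<fv) (minContrast-≤-above v~u (proj₁ (≰⇒> fu≰fv))))

  -- The mirror image of `tight-below`: `v` is moved up, below every `f u - p` of an upper neighbour
  -- and below the default `1#`.
  tight-above : ∀ {v} → Inner v → ∃[ u ] v ~ u × f v + minContrast v ≡ f u
  tight-above {v} inner@(_ , fv≢1) with Fin.any? (λ u → (v ~? u) ×-dec (f v + minContrast v ≟ f u))
  ... | yes tight = tight
  ... | no ¬tight = contradiction (λ {u} → better {u})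
        (no-better-shade inner
          (≤-trans (proj₁ (unit v)) (proj₁ fv<x) , ≤-trans (proj₁ x<min) (min≤⊤ 1# bounds)))
    where
    p = minContrast v
    above? : Decidable λ u → v ~ u × f v ≤ f u
    above? u = (v ~? u) ×-dec (f v ≤? f u)
    bounds = map (λ u → f u - p) (filter above? (allFin order))
    p+[y-p]≡y : ∀ y → p + (y - p) ≡ y
    p+[y-p]≡y = x+[y-x]≡y p
    bounds> : All.All (f v <_) bounds
    bounds> = All-map⁺ (All.map (λ {u} (v~u , fv≤fu) →
      +-cancelˡ-< p (subst₂ _<_ (+-comm (f v) p) (sym (p+[y-p]≡y (f u)))
        (minContrast-≤-above v~u fv≤fu , λ fv+p≡fu → ¬tight (_ , v~u , fv+p≡fu))))
      (all-filter above? (allFin order)))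
    fv<min : f v < min 1# bounds
    fv<min = v<min⁺ (proj₂ (unit v) , fv≢1) bounds>
    x = proj₁ (dense fv<min)
    fv<x = proj₁ (proj₂ (dense fv<min))
    x<min = proj₂ (proj₂ (dense fv<min))
    better : ∀ {u} → v ~ u → p < ∣ x - f u ∣
    better {u} v~u with f v ≤? f u
    ... | yes fv≤fu = <-∣-∣ (0≤minContrast v)
      (subst₂ _<_ (+-comm p x) (p+[y-p]≡y (f u)) (+-monoʳ-< p (<-≤-trans x<min min≤fu-p)))
      where
      min≤fu-p : min 1# bounds ≤ f u - p
      min≤fu-p = All.lookup (min≤xs 1# bounds)
        (∈-map⁺ (λ u → f u - p) (∈-filter⁺ above? (∈-allFin u) (v~u , fv≤fu)))
    ... | no fv≰fu = subst (p <_) (∣-∣-comm (f u) x) (<-∣-∣ (0≤minContrast v)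
      (≤-<-trans (minContrast-≤-below v~u (proj₁ (≰⇒> fv≰fu))) fv<x))

  -- Ladders of shades and the span of a vertex.

  -- Indexed by natural numbers and allowed to have fewer than two steps, unlike a chain, so that
  -- ladders can be built rung by rung and concatenated.
  Ladder : Carrier → Carrier → ℕ → Set
  Ladder p a n = ∀ {i} → i ℕ.≤ n → Im G f (a + ι i * p)

  ladder-rung : ∀ v {p} → Ladder p (f v) 0
  ladder-rung v {p} ℕ.z≤n = v , sym (a+0*p≡a (f v) p)

  ladder-∷ : ∀ {p v u n} → f v + p ≡ f u → Ladder p (f u) n → Ladder p (f v) (suc n)
  ladder-∷ {v = v} _ _ {zero} _ = ladder-rung v ℕ.z≤n
  ladder-∷ {p} {v} {u} fv+p≡fu L {suc i} (ℕ.s≤s i≤n) = subst (Im G f)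
    (trans (cong (_+ ι i * p) (sym fv+p≡fu))
      (trans (+-assoc (f v) p (ι i * p)) (cong (f v +_) (sym (ι-suc-* i p)))))
    (L i≤n)

  ladder-++ : ∀ {p a b m n} → a + ι m * p ≡ b → Ladder p a m → Ladder p b n → Ladder p a (m ℕ.+ n)
  ladder-++ {p} {a} {b} {m} {n} a+mp≡b L L' {i} i≤m+n with i ℕ.≤? m
  ... | yes i≤m = L i≤m
  ... | no i≰m  = subst (Im G f) (trans (cong (_+ ι (i ℕ.∸ m) * p) (sym a+mp≡b))
        (trans (sym (ι-+-* a m (i ℕ.∸ m) p)) (cong (λ j → a + ι j * p) (ℕ.m+[n∸m]≡n (ℕ.≰⇒≥ i≰m)))))
        (L' (ℕ.m≤n+o⇒m∸n≤o i m i≤m+n))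

  -- The condition for a climb with step `p` to stop. Extreme shades meet it vacuously; for inner
  -- ones it is what `Supported` and `generate` demand of the end of a chain.
  Settled : Vertex → Carrier → Set
  Settled u p = Inner u → minContrast u < p

  settled? : ∀ u {p} → minContrast u ≤ p → Settled u p ⊎ (Inner u × minContrast u ≡ p)
  settled? u {p} mu≤p with extreme-or-inner u | minContrast u ≟ p
  ... | _                  | no mu≢p  = inj₁ λ _ → mu≤p , mu≢p
  ... | inj₂ inner         | yes mu≡p = inj₂ (inner , mu≡p)
  ... | inj₁ (inj₁ fu≡0)   | _        = inj₁ λ (fu≢0 , _) → contradiction fu≡0 fu≢0
  ... | inj₁ (inj₂ fu≡1)   | _        = inj₁ λ (_ , fu≢1) → contradiction fu≡1 fu≢1

  -- The edge between the two vertices has contrast exactly `minContrast v`, and it competes for the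
  -- minimum at `u` as well.
  tight⇒minContrast-≤ : ∀ {u v} → v ~ u → f u + minContrast v ≡ f v ⊎ f v + minContrast v ≡ f u →
    minContrast u ≤ minContrast v
  tight⇒minContrast-≤ {u} {v} v~u tight =
    subst (minContrast u ≤_) (∣fu-fv∣≡p tight) (minContrast-≤ (~-sym v~u))
    where
    p = minContrast v
    ∣fu-fv∣≡p : f u + p ≡ f v ⊎ f v + p ≡ f u → ∣ f u - f v ∣ ≡ p
    ∣fu-fv∣≡p (inj₁ fu+p≡fv) = +-cancelˡ (f u) _ _
      (trans (∣-∣-≤ (subst (f u ≤_) fu+p≡fv (x≤x+y (f u) (0≤minContrast v)))) (sym fu+p≡fv))
    ∣fu-fv∣≡p (inj₂ fv+p≡fu) = +-cancelˡ (f v) _ _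
      (trans (∣-∣-≥ (subst (f v ≤_) fv+p≡fu (x≤x+y (f v) (0≤minContrast v)))) (sym fv+p≡fu))

  -- Each step of a climb is at least `h`, so the fuel `n`, which bounds the distance to `1#` in
  -- units of `h`, may drop by one.
  climb-≥ : ∀ {u v} n → f v + minContrast v ≡ f u → 1# ≤ f v + ι (suc n) * h → 1# ≤ f u + ι n * h
  climb-≥ {u} {v} n fv+p≡fu 1≤ = begin
    1#                               ≤⟨ 1≤ ⟩
    f v + ι (suc n) * h              ≡⟨ cong (f v +_) (ι-suc-* n h) ⟩
    f v + (h + ι n * h)              ≡⟨ +-assoc (f v) h (ι n * h) ⟨
    f v + h + ι n * h                ≤⟨ +-monoˡ-≤ (ι n * h) (+-monoʳ-≤ (f v) (h≤minContrast v)) ⟩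
    f v + minContrast v + ι n * h    ≡⟨ cong (_+ ι n * h) fv+p≡fu ⟩
    f u + ι n * h                    ∎
    where open ≤-Reasoning

  climb-≤ : ∀ {u v} n → f u + minContrast v ≡ f v → f v ≤ ι (suc n) * h → f u ≤ ι n * h
  climb-≤ {u} {v} n fu+p≡fv fv≤ = +-cancelˡ-≤ h (begin
    h + f u               ≡⟨ +-comm h (f u) ⟩
    f u + h               ≤⟨ +-monoʳ-≤ (f u) (h≤minContrast v) ⟩
    f u + minContrast v   ≡⟨ fu+p≡fv ⟩
    f v                   ≤⟨ fv≤ ⟩
    ι (suc n) * h         ≡⟨ ι-suc-* n h ⟩
    h + ι n * h           ∎)
    where open ≤-Reasoning

  -- The next rung comes from `tight-above`, and its smallest contrast is at most `p`. If the rung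
  -- is not settled, it is inner with smallest contrast equal to `p`, and the climb goes on with the
  -- same step. Without fuel, `f v` would be `1#`.
  ascend : ∀ n {v p} → Inner v → minContrast v ≡ p → 1# ≤ f v + ι n * h →
    ∃[ u ] ∃[ r ] 1 ℕ.≤ r × Ladder p (f v) r × f v + ι r * p ≡ f u × Settled u p
  ascend zero {v} (_ , fv≢1) refl 1≤fv = contradiction
    (≤-antisym (proj₂ (unit v)) (subst (1# ≤_) (a+0*p≡a (f v) h) 1≤fv)) fv≢1
  ascend (suc n) {v} inner refl 1≤ with u , v~u , fv+p≡fu ← tight-above inner
    with settled? u (tight⇒minContrast-≤ v~u (inj₂ fv+p≡fu))
  ... | inj₁ settled = u , 1 , ℕ.≤-refl , ladder-∷ fv+p≡fu (ladder-rung u) ,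
        trans (cong (f v +_) (ι-1-* _)) fv+p≡fu , settled
  ... | inj₂ (inner-u , mu≡mv)
    with w , r , 1≤r , L , fu+rp≡fw , settled ← ascend n inner-u mu≡mv (climb-≥ n fv+p≡fu 1≤) =
        w , suc r , ℕ.s≤s ℕ.z≤n , ladder-∷ fv+p≡fu L ,
        trans (cong (f v +_) (ι-suc-* r _)) (trans (sym (+-assoc (f v) _ _))
          (trans (cong (_+ ι r * minContrast v) fv+p≡fu) fu+rp≡fw)) , settled

  -- As `ascend`, but a ladder is based at its lowest point, so the rung from `f u` to `f v` is
  -- attached at the top by `ladder-++`.
  descend : ∀ n {v p} → Inner v → minContrast v ≡ p → f v ≤ ι n * h →
    ∃[ u ] ∃[ r ] 1 ℕ.≤ r × Ladder p (f u) r × f u + ι r * p ≡ f v × Settled u p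
  descend zero {v} (fv≢0 , _) refl fv≤0 = contradiction
    (≤-antisym (subst (f v ≤_) (zeroˡ h) fv≤0) (proj₁ (unit v))) fv≢0
  descend (suc n) {v} inner refl fv≤ with u , v~u , fu+p≡fv ← tight-below inner
    with settled? u (tight⇒minContrast-≤ v~u (inj₁ fu+p≡fv))
  ... | inj₁ settled = u , 1 , ℕ.≤-refl , ladder-∷ fu+p≡fv (ladder-rung v) ,
        trans (cong (f u +_) (ι-1-* _)) fu+p≡fv , settled
  ... | inj₂ (inner-u , mu≡mv)
    with w , r , 1≤r , L , fw+rp≡fu , settled ← descend n inner-u mu≡mv (climb-≤ n fu+p≡fv fv≤) =
        w , r ℕ.+ 1 , ℕ.m≤n+m 1 r , ladder-++ {b = f u} fw+rp≡fu L (ladder-∷ fu+p≡fv (ladder-rung v)) ,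
        trans (ι-+-* (f w) r 1 _) (trans (cong₂ _+_ fw+rp≡fu (ι-1-* _)) fu+p≡fv) , settled

  -- The common source of the chains in `IsMinimumStepEnchained` and of the `generate` steps in `R`.
  record Span (v : Vertex) : Set where
    field
      bottom top     : Vertex
      position steps : ℕ
      0<position     : 1 ℕ.≤ position
      position<steps : position ℕ.< steps
      ladder         : Ladder (minContrast v) (f bottom) steps
      at-position    : f bottom + ι position * minContrast v ≡ f v
      at-steps       : f bottom + ι steps * minContrast v ≡ f top
      bottom-settled : Settled bottom (minContrast v)
      top-settled    : Settled top (minContrast v)

    2≤steps : 2 ℕ.≤ steps
    2≤steps = ℕ.≤-trans (ℕ.s≤s 0<position) position<steps

  span : ∀ {v} → Inner v → Span v
  -- The fuel `k` suffices in both directions, since `k` steps of length `h` cover the unit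
  -- interval.
  span {v} inner
    with a , m , 1≤m , L , a+mp≡fv , settled-a ← descend k inner refl
      (subst (f v ≤_) (sym (ι*1/ 1≤k)) (proj₂ (unit v)))
    with b , n , 1≤n , L' , fv+np≡b , settled-b ← ascend k inner refl
      (subst (λ y → 1# ≤ f v + y) (sym (ι*1/ 1≤k))
        (subst (1# ≤_) (+-comm 1# (f v)) (x≤x+y 1# (proj₁ (unit v)))))
    = record
    { bottom = a ; top = b ; position = m ; steps = m ℕ.+ n
    ; 0<position = 1≤m ; position<steps = ℕ.m<m+n m 1≤n
    ; ladder = ladder-++ {b = f v} a+mp≡fv L L'
    ; at-position = a+mp≡fv
    ; at-steps = trans (ι-+-* (f a) m n _) (trans (cong (_+ ι n * minContrast v) a+mp≡fv) fv+np≡b)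
    ; bottom-settled = settled-a ; top-settled = settled-b
    }

  -- Chains inside the image.

  Im⊆UnitInterval : Im G f ⊆ UnitInterval
  Im⊆UnitInterval (v , fv≡y) = subst UnitInterval fv≡y (unit v)

  ladder⇒chain : ∀ {p a b r} → 2 ℕ.≤ r → 0# < p → Ladder p a r → a + ι r * p ≡ b →
                 ChainIn (Im G f) p a b
  ladder⇒chain {p} {a} {b} {r} 2≤r 0<p L a+rp≡b = record
    { point   = point
    ; isChain = record { 2≤r = 2≤r ; 0<p = 0<p ; unit = Im⊆UnitInterval ∘ inIm ; step = step }
    ; inF     = inIm
    ; first   = a+0*p≡a a p
    ; last    = trans (cong (λ n → a + ι n * p) (Fin.toℕ-fromℕ r)) a+rp≡b
    }
    where
    point : Fin (suc r) → Carrier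
    point i = a + ι (toℕ i) * p
    inIm : ∀ i → Im G f (point i)
    inIm i = L (Fin.toℕ≤pred[n] i)
    step : ∀ (i : Fin r) → point (Fin.suc i) - point (inject₁ i) ≡ p
    step i rewrite Fin.toℕ-inject₁ i = x+y≡z⇒z-x≡y
      (trans (+-assoc a _ p) (cong (a +_) (trans (+-comm _ p) (sym (ι-suc-* (toℕ i) p)))))

  module _ {v} (s : Span v) where
    open Span s

    span⇒interior : IsInteriorOf (Im G f) (minContrast v) (f bottom) (f top) (f v)
    span⇒interior = ladder⇒chain 2≤steps (0<minContrast v) ladder at-steps ,
      fromℕ< position<1+steps ,
      subst (0 ℕ.<_) (sym toℕ≡) 0<position , subst (ℕ._< steps) (sym toℕ≡) position<steps ,
      trans (cong (λ n → f bottom + ι n * minContrast v) toℕ≡) at-position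
      where
      position<1+steps : position ℕ.< suc steps
      position<1+steps = ℕ.m<n⇒m<1+n position<steps
      toℕ≡ : toℕ (fromℕ< position<1+steps) ≡ position
      toℕ≡ = Fin.toℕ-fromℕ< position<1+steps

    step≡ : minContrast v ≡ (f top - f bottom) / steps
    step≡ = trans (sym (*-/-cancel (ℕ.≤-trans (ℕ.s≤s ℕ.z≤n) 2≤steps) (minContrast v)))
      (cong (_/ steps) (sym (x+y≡z⇒z-x≡y at-steps)))

    bottom<top : f bottom < f top
    bottom<top = subst (f bottom <_) at-steps (x<x+y (f bottom)
      (<-≤-trans (0<minContrast v) (ι-*-≥ (ℕ.≤-trans (ℕ.s≤s ℕ.z≤n) 2≤steps) (0≤minContrast v))))

  -- Derivations in `F k`.

  extreme-R : ∀ {y} → y ≡ 0# ⊎ y ≡ 1# → R k y 0#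
  extreme-R (inj₁ refl) = zero
  extreme-R (inj₂ refl) = one

  -- The order of the reals is not well-founded, but its pullback along `minContrast` to the finite
  -- vertex set is. Each end of the span of `v` is extreme, carrying `0#`, or inner with a smaller
  -- minimum, hence derived earlier.
  generated : ∀ {v} → Inner v → R k (f v) (minContrast v)
  generated {v} = go (spo-wellFounded (On.isStrictPartialOrder minContrast <-isStrictPartialOrder) v)
    where
    go : ∀ {v} → Acc (λ u w → minContrast u < minContrast w) v → Inner v → R k (f v) (minContrast v)
    go {v} (acc rec) inner = subst (λ y → R k y (minContrast v)) at-position
      (generate (proj₁ (proj₂ bottomR)) (proj₁ (proj₂ topR)) (bottom<top s) 2≤steps (step≡ s)
        (h≤minContrast v) (proj₂ (proj₂ bottomR)) (proj₂ (proj₂ topR)) 0<position position<steps)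
      where
      s : Span v
      s = span inner
      open Span s
      value : ∀ u → Settled u (minContrast v) → ∃[ q ] R k (f u) q × q < minContrast v
      value u settled with extreme-or-inner u
      ... | inj₁ extreme = 0# , extreme-R extreme , 0<minContrast v
      ... | inj₂ inner-u = minContrast u , go (rec (settled inner-u)) inner-u , settled inner-u
      bottomR = value bottom bottom-settled
      topR    = value top top-settled

  Im⊆F : Im G f ⊆ F k
  Im⊆F (v , refl) with extreme-or-inner v
  ... | inj₁ extreme = 0# , extreme-R extreme
  ... | inj₂ inner   = minContrast v , generated inner

  -- A generated point lies at least one step `p`, hence at least `h`, above its left end, which is
  -- nonnegative by induction.
  R⇒0⊎h≤ : ∀ {y q} → R k y q → y ≡ 0# ⊎ h ≤ y
  R⇒0⊎h≤ zero = inj₁ refl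
  R⇒0⊎h≤ one  = inj₂ (subst (h ≤_) (ι*1/ 1≤k) (ι-*-≥ 1≤k (proj₁ 0<h)))
  R⇒0⊎h≤ (generate {y₁ = y₁} {p = p} {j = j} Ry₁ _ _ _ _ h≤p _ _ 1≤j _) = inj₂ (begin
    h              ≤⟨ h≤p ⟩
    p              ≤⟨ ι-*-≥ 1≤j (≤-trans (proj₁ 0<h) h≤p) ⟩
    ι j * p        ≡⟨ +-identityˡ _ ⟨
    0# + ι j * p   ≤⟨ +-monoˡ-≤ (ι j * p) ([ ≤-reflexive ∘ sym , ≤-trans (proj₁ 0<h) ]′ (R⇒0⊎h≤ Ry₁)) ⟩
    y₁ + ι j * p   ∎)
    where open ≤-Reasoning

  -- The second point of such a chain is `q` itself. It belongs to `F k`, although it lies strictly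
  -- between `0#` and `h`.
  no-finer-chain : ∀ q → q < h → ¬ ChainIn (Im G f) q 0# 1#
  no-finer-chain q q<h record
    { point = y ; inF = inF ; first = y₀≡0
    -- Matching on `2≤r` exposes `r` as a successor, so that the chain has a point after the first.
    ; isChain = record { 2≤r = ℕ.s≤s _ ; 0<p = 0<q ; step = step } }
    with R⇒0⊎h≤ (proj₂ (Im⊆F (subst (Im G f)
           (trans (sym (x+[y-x]≡y (y Fin.zero) _))
             (trans (cong₂ _+_ y₀≡0 (step Fin.zero)) (+-identityˡ q)))
           (inF (Fin.suc Fin.zero)))))
  ... | inj₁ q≡0 = proj₂ 0<q (sym q≡0)
  ... | inj₂ h≤q = <⇒≱ q<h h≤q

  -- The three conclusions.

  I⊆Im : I k ⊆ Im G f
  I⊆Im (i , i≤k , refl) = subst (Im G f) (cong (ι i *_) (*-identityˡ _))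
    (grid⊆Im 1≤k chromatic greyscale h≤contrast i≤k)

  isMinimumStepEnchained : IsMinimumStepEnchained h (Im G f)
  isMinimumStepEnchained = record
    { unit     = Im⊆UnitInterval
    ; chain    = ladder⇒chain 2≤k 0<h
                   (λ i≤k → subst (Im G f) (sym (+-identityˡ _)) (grid⊆Im 1≤k chromatic greyscale h≤contrast i≤k))
                   (trans (+-identityˡ _) (ι*1/ 1≤k))
    ; minimum  = no-finer-chain
    ; interior = λ { _ (v , refl) fv≢0 fv≢1 → interior (span (fv≢0 , fv≢1)) }
    }
    where
    -- A copy of the record's local `Supported`, so that `supported` can be stated before the record
    -- is inhabited.
    SupportedIn : Carrier → Carrier → Set
    SupportedIn p y = h < p → y ≢ 0# → y ≢ 1# →
      ∃[ q ] h ≤ q × q < p × ∃[ a ] ∃[ b ] IsInteriorOf (Im G f) q a b y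
    supported : ∀ {u p} → Settled u p → SupportedIn p (f u)
    supported {u} settled _ fu≢0 fu≢1 =
      minContrast u , h≤minContrast u , settled (fu≢0 , fu≢1) , _ , _ , span⇒interior (span (fu≢0 , fu≢1))
    interior : ∀ {v} → Span v → ∃[ p ] h ≤ p × ∃[ y₁ ] ∃[ y₂ ]
      IsInteriorOf (Im G f) p y₁ y₂ (f v) × SupportedIn p y₁ × SupportedIn p y₂
    interior {v} s = minContrast v , h≤minContrast v , _ , _ , span⇒interior s ,
      supported (Span.bottom-settled s) , supported (Span.top-settled s)

theorem4p4 : (ℝ : RealField) → let open Contrast ℝ in
    (G : Graph) (k : ℕ) → 2 ≤ℕ k →
    Graph.Connected G → Graph.HasChromaticNumber G (suc k) →
    (f : Graph.Vertex G → Carrier) → IsMaximumContrastGreyscale G f →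
    IsMinimumStepEnchained (1# / k) (Im G f) × I k ⊆ Im G f × Im G f ⊆ F k
theorem4p4 ℝ G k 2≤k connected chromatic f f-max = isMinimumStepEnchained , I⊆Im , Im⊆F
  where
  open MaximumContrast ℝ G k 2≤k connected chromatic f f-max
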